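{- Let $D$ be a finite simple directed acyclic graph. The acyclic reorientation poset $\mathcal{AR}_D$ is a lattice if and only if $D$ is vertebrate.
   Context: Let $D=(V,A)$ be a finite simple directed acyclic graph (no loops, at most one arc between two vertices). A reorientation of $D$ is a directed graph with the same underlying undirected graph as $D$; it is encoded by the set of arcs of $D$ that it reverses. The acyclic reorientation poset $\mathcal{AR}_D$ is the set of acyclic reorientations of $D$ (those with no directed cycle), ordered by inclusion of their sets of reversed arcs. The transitive reduction of a directed acyclic graph is the directed graph obtained by deleting all arcs whose endpoints are connected by a directed path of length at least $2$. A directed graph is called a forest if its underlying undirected graph has no cycle. $D$ is vertebrate if, for every $U\subseteq V$, the transitive reduction of the subgraph of $D$ induced by $U$ is a forest. -}

module Defs where

open import Data.Bool.Base using (Bool; T)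
open import Data.Fin.Base using (Fin)
open import Data.Fin.Subset using (Subset; _∈_)
open import Data.List.Base using (List; _∷_; _∷ʳ_; length)
open import Data.List.Relation.Unary.Linked using (Linked)
open import Data.List.Relation.Unary.Unique.Propositional using (Unique)
open import Data.Nat.Base using (ℕ; _≤_)
open import Data.Product.Base using (_×_; _,_; proj₁; proj₂; ∃₂; swap)
open import Function.Base using (id)
open import Level using (Level; 0ℓ; _⊔_)
open import Relation.Binary.Bundles using (Poset)
open import Relation.Binary.Core using (Rel; _⇒_; _⇔_)
open import Relation.Binary.Construct.Closure.Symmetric using (SymClosure; fwd; bwd)
open import Relation.Binary.Definitions using (Irreflexive; Asymmetric)
open import Relation.Binary.Lattice.Structures using (IsLattice)
open import Relation.Binary.PropositionalEquality.Core using (_≡_)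
open import Relation.Nullary.Negation.Core using (¬_; contradiction)

private
  variable
    n : ℕ
    a ℓ ℓ₁ ℓ₂ : Level

-- Paths and cycles have pairwise distinct vertices.

-- The cycle x → x₁ → … → xₖ → x, where xs is the list x₁, …, xₖ.
IsCycle : {V : Set a} → Rel V ℓ → V → List V → Set (a ⊔ ℓ)
IsCycle R x xs = Linked R (x ∷ xs ∷ʳ x) × Unique (x ∷ xs)

-- The path u → w → w₁ → … → wₖ → v, where ws is the list w₁, …, wₖ;
-- it has an interior vertex w, so its length is at least 2.
IsLongPath : {V : Set a} → Rel V ℓ → V → V → V → List V → Set (a ⊔ ℓ)
IsLongPath R u v w ws =
  Linked R (u ∷ w ∷ ws ∷ʳ v) × Unique (u ∷ w ∷ ws ∷ʳ v)

Acyclic : {V : Set a} → Rel V ℓ → Set (a ⊔ ℓ)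
Acyclic R = ¬ ∃₂ λ x xs → IsCycle R x xs

TransitiveReduction : {V : Set a} → Rel V ℓ → Rel V (a ⊔ ℓ)
TransitiveReduction R u v = R u v × ¬ ∃₂ λ w ws → IsLongPath R u v w ws

-- Cycles in a simple undirected graph have at least three vertices;
-- without this bound, every edge {x , y} would give a cycle x, y, x.
Forest : {V : Set a} → Rel V ℓ → Set (a ⊔ ℓ)
Forest R =
  ¬ ∃₂ λ x xs → 3 ≤ length (x ∷ xs) × IsCycle (SymClosure R) x xs

-- The subgraph induced by U, on the same vertex type: vertices outside U
-- remain as isolated vertices, which lie on no cycle and on no long path.
Induced : Subset n → Rel (Fin n) ℓ → Rel (Fin n) ℓ
Induced U R u v = u ∈ U × v ∈ U × R u v

record Digraph (n : ℕ) : Set where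
  constructor digraph
  field
    arc : Fin n → Fin n → Bool

  Arc : Rel (Fin n) 0ℓ
  Arc u v = T (arc u v)

open Digraph public using (Arc)

record Simple (D : Digraph n) : Set where
  field
    loopless : Irreflexive _≡_ (Arc D)
    oneArc   : Asymmetric (Arc D)

Vertebrate : Digraph n → Set
Vertebrate {n} D =
  (U : Subset n) → Forest (TransitiveReduction (Induced U (Arc D)))

record IsReorientation (D E : Digraph n) : Set where
  field
    simple    : Simple E
    sameEdges : SymClosure (Arc D) ⇔ SymClosure (Arc E)

  open Simple simple public

record AcyclicReorientation (D : Digraph n) : Set where
  field
    graph           : Digraph n
    isReorientation : IsReorientation D graph
    acyclic         : Acyclic (Arc graph)

  open IsReorientation isReorientation public

-- The arcs of D that E reverses.
Reversed : Digraph n → Digraph n → Rel (Fin n) 0ℓ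
Reversed D E u v = Arc D u v × Arc E v u

module _ (D : Digraph n) where

  open AcyclicReorientation

  _≈ᴬᴿ_ _≤ᴬᴿ_ : Rel (AcyclicReorientation D) 0ℓ
  E ≈ᴬᴿ F = Arc (graph E) ⇔ Arc (graph F)
  E ≤ᴬᴿ F = Reversed D (graph E) ⇒ Reversed D (graph F)

  private
    antisym-⇒ : ∀ E F → E ≤ᴬᴿ F → F ≤ᴬᴿ E → Arc (graph E) ⇒ Arc (graph F)
    antisym-⇒ E F E≤F F≤E uv with proj₂ (sameEdges E) (fwd uv)
    ... | bwd d = proj₂ (E≤F (d , uv))
    ... | fwd d with proj₁ (sameEdges F) (fwd d)
    ...   | fwd uv′ = uv′
    ...   | bwd vu  = contradiction (proj₂ (F≤E (d , vu))) (oneArc E uv)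

  AcyclicReorientationPoset : Poset 0ℓ 0ℓ 0ℓ
  AcyclicReorientationPoset = record
    { Carrier        = AcyclicReorientation D
    ; _≈_            = _≈ᴬᴿ_
    ; _≤_            = _≤ᴬᴿ_
    ; isPartialOrder = record
      { isPreorder = record
        { isEquivalence = record
          { refl  = id , id
          ; sym   = swap
          ; trans = λ (f , f⁻¹) (g , g⁻¹) → (λ e → g (f e)) , (λ e → f⁻¹ (g⁻¹ e))
          }
        ; reflexive = λ (f , _) (d , e) → d , f e
        ; trans     = λ E≤F F≤G r → F≤G (E≤F r)
        }
      ; antisym = λ {E} {F} E≤F F≤E →
          antisym-⇒ E F E≤F F≤E , antisym-⇒ F E F≤E E≤F
      }
    }

IsLatticePoset : Poset a ℓ₁ ℓ₂ → Set (a ⊔ ℓ₁ ⊔ ℓ₂)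
IsLatticePoset P = ∃₂ λ _∨_ _∧_ → IsLattice _≈_ _≤ᴾ_ _∨_ _∧_
  where open Poset P renaming (_≤_ to _≤ᴾ_)

{-# OPTIONS --safe #-}
-- If the reduction T of the subgraph induced by some U contains a cycle, reverse
-- all arcs that leave U, and inside U either a single arc of T or everything but
-- a single arc of T: both stay acyclic.  A join of the reorientations that reverse
-- a single backward arc of the cycle reverses all its backward arcs, and none of
-- its forward arcs, since it lies below the reorientations that spare one of
-- them.  So it turns the cycle into a directed one.
--
-- Conversely, an upper bound of E and F reverses every arc u → v of D for which
-- there is a walk u ⇝ v of arcs reversed in E or in F.  Let Z be the set of these
-- arcs.  It remains to see that reversing exactly Z leaves no cycle.  In a
-- shortest one, which is chordless, some arc is not in the reduction of the
-- induced subgraph, so that D restricted to the cycle is a path u ⇝ v with the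
-- arc u → v.  Hence either all arcs of the path are in Z and u → v is not, which
-- is absurd, or u → v is in Z and no arc of the path is.  In the latter case the
-- path and a walk u ⇝ v of reversed arcs have a common refinement, because they
-- span a subgraph whose reduction is a forest.  Following it from u to v, the
-- acyclicity of E and F forces some arc of the path into Z.  Meets are obtained
-- by reversing all arcs.
module Submission where

open import Defs
open import Data.Bool.Properties using (T?)
open import Data.Empty using (⊥)
open import Data.Fin.Base using (Fin; zero; suc)
open import Data.Fin.Properties using (_≟_; any?; injective⇒≤)
open import Data.Fin.Subset using (Subset; ⁅_⁆; _∪_) renaming (⊥ to ∅; _∈_ to _∈ˢ_; _∉_ to _∉ˢ_)
open import Data.Fin.Subset.Properties
  using (_∈?_; ∉⊥; x∈⁅x⁆; x∈⁅y⁆⇒x≡y; x∈p∪q⁺; x∈p∪q⁻)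
open import Data.List.Base using (List; []; _∷_; _∷ʳ_; _++_; foldr; length; lookup; reverse)
import Data.List.Membership.DecPropositional as DecMembership
open import Data.List.Membership.Propositional using (_∈_; _∉_)
open import Data.List.Membership.Propositional.Properties
  using (∈-∃++; ∈-lookup; ∈-++⁺ˡ; ∈-++⁺ʳ; ∈-++⁻)
open import Data.List.Properties
  using (++-assoc; length-++; length-++-≤ʳ; length-++-comm; length-++-sucʳ; length-reverse; unfold-reverse)
open import Data.List.Relation.Binary.Permutation.Propositional using (↭-sym; ↭⇒↭ₛ)
open import Data.List.Relation.Binary.Permutation.Propositional.Properties using (↭-reverse; ∈-resp-↭)
import Data.List.Relation.Binary.Permutation.Setoid.Properties as SetoidPerm
open import Data.List.Relation.Binary.Sublist.Propositional as Sub using (_⊆_)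
open import Data.List.Relation.Binary.Sublist.Propositional.Properties using (length-mono-≤)
open import Data.List.Relation.Unary.All using ([]; _∷_)
open import Data.List.Relation.Unary.All.Properties as All using (¬Any⇒All¬; All¬⇒¬Any)
open import Data.List.Relation.Unary.AllPairs using ([]; _∷_)
open import Data.List.Relation.Unary.Any using (here; there)
open import Data.List.Relation.Unary.Linked using (Linked; []; [-]; _∷_)
open import Data.List.Relation.Unary.Unique.Propositional using (Unique)
open import Data.List.Relation.Unary.Unique.Propositional.Properties using (++⁺)
open import Data.Nat.Base using (ℕ; zero; suc; _+_; _≤_; _<_; z≤n; s≤s)
import Data.Nat.Properties as ℕ
open import Data.Product.Base using (_×_; _,_; proj₁; proj₂; ∃₂; ∃-syntax; -,_)
open import Data.Sum.Base as Sum using (_⊎_; inj₁; inj₂)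
open import Function.Base using (flip; _∘_; id)
open import Function.Bundles using (_⇔_; mk⇔)
open import Level using (0ℓ)
open import Relation.Binary.Bundles using (Poset)
open import Relation.Binary.Construct.Closure.Symmetric as Sym using (SymClosure; fwd; bwd)
open import Relation.Binary.Core using (Rel; _⇒_)
open import Relation.Binary.Definitions using (Asymmetric; Decidable)
open import Relation.Binary.Lattice.Structures using (IsLattice)
open import Relation.Binary.PropositionalEquality
  using (_≡_; _≢_; refl; sym; trans; cong; subst; subst₂; setoid)
open import Relation.Nullary.Decidable
  using (Dec; yes; no; ⌊_⌋; map′; toWitness; fromWitness; ¬?; _×-dec_; _⊎-dec_)
open import Relation.Nullary.Negation using (¬_; contradiction)

private
  variable
    n : ℕ
    R S : Rel (Fin n) 0ℓ
    u v x y z a b c : Fin n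
    us ws qs xs ys zs : List (Fin n)

infixr 5 _∷_ _++ʷ_

-- Walks

-- The list records the vertices after the first one.
data Walk (R : Rel (Fin n) 0ℓ) : Fin n → List (Fin n) → Fin n → Set where
  []  : Walk R x [] x
  _∷_ : R x y → Walk R y ys z → Walk R x (y ∷ ys) z

Reach : Rel (Fin n) 0ℓ → Rel (Fin n) 0ℓ
Reach R x y = ∃[ zs ] Walk R x zs y

-- Acyclicity with repeated vertices allowed, so that walks can be concatenated freely. The last
-- step stands apart to keep the closed walk nonempty.
NoClosed : Rel (Fin n) 0ℓ → Set
NoClosed R = ∀ {x xs y} → Walk R x xs y → ¬ R y x

_++ʷ_ : Walk R x xs y → Walk R y ys z → Walk R x (xs ++ ys) z
[]      ++ʷ w′ = w′
(r ∷ w) ++ʷ w′ = r ∷ (w ++ʷ w′)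

mapʷ : R ⇒ S → Walk R x xs y → Walk S x xs y
mapʷ f []      = []
mapʷ f (r ∷ w) = f r ∷ mapʷ f w

flipʷ : Walk R x xs y → Reach (flip R) y x
flipʷ []      = -, []
flipʷ (r ∷ w) = -, proj₂ (flipʷ w) ++ʷ (r ∷ [])

unsnoc : Walk R x (y ∷ ys) z → ∃₂ λ zs p → Walk R x zs p × R p z
unsnoc (r ∷ [])     = -, -, [] , r
unsnoc (r ∷ r′ ∷ w) = let _ , _ , w′ , s = unsnoc (r′ ∷ w) in -, -, r ∷ w′ , s

end∈ : Walk R x xs y → y ∈ x ∷ xs
end∈ []      = here refl
end∈ (_ ∷ w) = there (end∈ w)

splitAtʷ : ∀ p {q} → Walk R x (p ++ a ∷ q) y → (∃[ b ] Walk R x p b × R b a) × Walk R a q y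
splitAtʷ []      (r ∷ w) = (-, [] , r) , w
splitAtʷ (_ ∷ p) (r ∷ w) =
  let (_ , w₁ , s) , w₂ = splitAtʷ p w in (-, r ∷ w₁ , s) , w₂

splitʷ : Walk R x xs y → a ∈ xs →
  ∃₂ λ p q → xs ≡ p ++ a ∷ q × (∃[ b ] Walk R x p b × R b a) × Walk R a q y
splitʷ w a∈ with p , q , refl ← ∈-∃++ a∈ = p , q , refl , splitAtʷ p w

noClosed-flip : NoClosed R → NoClosed (flip R)
noClosed-flip nc w r = nc (proj₂ (flipʷ w)) r

noClosed-map : R ⇒ S → NoClosed S → NoClosed R
noClosed-map f nc w r = nc (mapʷ f w) (f r)

walk⇒linked : Walk R x xs y → R y z → Linked R (x ∷ xs ∷ʳ z)
walk⇒linked []      s = s ∷ [-]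
walk⇒linked (r ∷ w) s = r ∷ walk⇒linked w s

linked⇒walk : ∀ xs → Linked R (x ∷ xs ∷ʳ z) → ∃[ y ] Walk R x xs y × R y z
linked⇒walk []       (r ∷ [-]) = -, [] , r
linked⇒walk (_ ∷ xs) (r ∷ l)   = let _ , w , s = linked⇒walk xs l in -, r ∷ w , s

unique-++⁻ˡ : ∀ {xs ys : List (Fin n)} → Unique (xs ++ ys) → Unique xs
unique-++⁻ˡ {xs = []}     _        = []
unique-++⁻ˡ {xs = x ∷ xs} (∉ ∷ un) = All.++⁻ˡ xs ∉ ∷ unique-++⁻ˡ un

unique⇒∉ : Unique (x ∷ xs) → x ∉ xs
unique⇒∉ (≢s ∷ _) = All¬⇒¬Any ≢s

∉⇒unique : x ∉ xs → Unique xs → Unique (x ∷ xs)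
∉⇒unique ∉ un = ¬Any⇒All¬ _ ∉ ∷ un

split-∉ˡ : ∀ p {q} → Unique (p ++ a ∷ q) → a ∉ p
split-∉ˡ (_ ∷ p) un (here refl) = unique⇒∉ un (∈-++⁺ʳ p (here refl))
split-∉ˡ (_ ∷ p) (_ ∷ un) (there a∈p) = split-∉ˡ p un a∈p

length-split : ∀ (p : List (Fin n)) {a q} → length p < length (p ++ a ∷ q)
length-split p {a} {q} = subst (length p <_) (sym (length-++ p)) (ℕ.m<m+n (length p) (s≤s z≤n))

-- The tail is treated first: if it is free of repetitions but meets `x` again, the walk up to that
-- return is a cycle. The bound on its length serves the study of shortest cycles.
walk-unique : Walk R x xs y →
  Unique (x ∷ xs) ⊎
  ∃₂ λ a zs → ∃[ b ] Walk R a zs b × R b a × Unique (a ∷ zs) × length zs < length xs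
walk-unique [] = inj₁ ([] ∷ [])
walk-unique {x = x} {xs = xs} (r ∷ w) with walk-unique w
... | inj₂ (_ , _ , _ , w′ , s , un , lt) = inj₂ (-, -, -, w′ , s , un , ℕ.m<n⇒m<1+n lt)
... | inj₁ un with DecMembership._∈?_ _≟_ x xs
...   | no x∉   = inj₁ (∉⇒unique x∉ un)
...   | yes x∈ with splitʷ (r ∷ w) x∈
...     | p , _ , eq , (_ , w′ , s) , _ =
  inj₂ (-, -, -, w′ , s , ∉⇒unique (split-∉ˡ p un′) (unique-++⁻ˡ un′) ,
        subst (λ l → length p < length l) (sym eq) (length-split p))
  where un′ = subst Unique eq un

module _ {n} {R : Rel (Fin n) 0ℓ} where

  noClosed⇒unique : NoClosed R → Walk R x xs y → Unique (x ∷ xs)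
  noClosed⇒unique nc w with walk-unique w
  ... | inj₁ un                    = un
  ... | inj₂ (_ , _ , _ , w′ , s , _) = contradiction s (nc w′)

  acyclic⇒noClosed : Acyclic R → NoClosed R
  acyclic⇒noClosed ac w s with walk-unique w
  ... | inj₁ un                         = ac (-, -, walk⇒linked w s , un)
  ... | inj₂ (_ , _ , _ , w′ , s′ , un , _) = ac (-, -, walk⇒linked w′ s′ , un)

  noClosed⇒acyclic : NoClosed R → Acyclic R
  noClosed⇒acyclic nc (_ , xs , l , _) = let _ , w , s = linked⇒walk xs l in nc w s

  noClosed⇒≢ : NoClosed R → R x y → x ≢ y
  noClosed⇒≢ nc r refl = nc [] r

-- Decidability of reachability and long paths

unique-lookup : ∀ {xs : List (Fin n)} → Unique xs → ∀ {i j} → lookup xs i ≡ lookup xs j → i ≡ j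
unique-lookup {xs = _ ∷ _} un       {zero}  {zero}  eq = refl
unique-lookup {xs = _ ∷ _} un       {zero}  {suc j} eq =
  contradiction (subst (_∈ _) (sym eq) (∈-lookup j)) (unique⇒∉ un)
unique-lookup {xs = _ ∷ _} un       {suc i} {zero}  eq =
  contradiction (subst (_∈ _) eq (∈-lookup i)) (unique⇒∉ un)
unique-lookup {xs = _ ∷ _} (_ ∷ un) {suc i} {suc j} eq = cong suc (unique-lookup un eq)

unique-length : {xs : List (Fin n)} → Unique xs → length xs ≤ n
unique-length un = injective⇒≤ (unique-lookup un)

module _ {n} {R : Rel (Fin n) 0ℓ} (R? : Decidable R) where

  shortReach? : ∀ k x y → Dec (∃[ zs ] Walk R x zs y × length zs ≤ k)
  shortReach? zero x y = map′ (λ { refl → [] , [] , z≤n }) (λ { ([] , [] , _) → refl }) (x ≟ y)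
  shortReach? (suc k) x y = map′
    (λ { (inj₁ refl) → [] , [] , z≤n
       ; (inj₂ (_ , r , _ , w , le)) → -, r ∷ w , s≤s le })
    (λ { (_ , [] , _) → inj₁ refl
       ; (_ , r ∷ w , s≤s le) → inj₂ (-, r , -, w , le) })
    (x ≟ y ⊎-dec any? (λ z → R? x z ×-dec shortReach? k z y))

  -- Without closed walks the vertices of a walk are distinct, so there are at most `n` of them and
  -- the bounded search is exhaustive.
  reach? : NoClosed R → Decidable (Reach R)
  reach? nc x y = map′
    (λ (_ , w , _) → -, w)
    (λ (_ , w) → -, w , ℕ.≤-trans (ℕ.n≤1+n _) (unique-length (noClosed⇒unique nc w)))
    (shortReach? n x y)

-- Distinctness of the vertices is automatic here, so a long path amounts to a walk of at least two
-- arcs, a form that can be searched for.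
longPath⁺ : NoClosed R → R u x → R x y → Reach R y v → ∃₂ (IsLongPath R u v)
longPath⁺ nc r s (_ , w) =
  let _ , _ , w′ , t = unsnoc (s ∷ w)
  in -, -, walk⇒linked (r ∷ w′) t , noClosed⇒unique nc ((r ∷ w′) ++ʷ (t ∷ []))

longPath⁻ : ∃₂ (IsLongPath R u v) → ∃₂ λ x y → R u x × R x y × Reach R y v
longPath⁻ (_ , ws , r ∷ l , _) with linked⇒walk ws l
... | _ , [] , t     = -, -, r , t , -, []
... | _ , s ∷ w , t = -, -, r , s , -, w ++ʷ (t ∷ [])

unique-reverse : Unique xs → Unique (reverse xs)
unique-reverse {xs = xs} =
  SetoidPerm.Unique-resp-↭ (setoid _) (↭⇒↭ₛ (↭-sym (↭-reverse xs)))

∈-reverse⁻ : x ∈ reverse xs → x ∈ xs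
∈-reverse⁻ {xs = xs} = ∈-resp-↭ (↭-reverse xs)

reverseʷ : Walk R x xs y → R y z → Walk (flip R) z (reverse (x ∷ xs)) x
reverseʷ []                            s = s ∷ []
reverseʷ {x = x} {xs = xs} (r ∷ w) s =
  subst (λ l → Walk _ _ l _) (sym (unfold-reverse x xs)) (reverseʷ w s ++ʷ (r ∷ []))

firstMeeting : a ∈ xs → a ∈ ys →
  ∃₂ λ p c → ∃[ q ] xs ≡ p ++ c ∷ q × c ∈ ys × (∀ {z} → z ∈ p → z ∉ ys)
firstMeeting {xs = x ∷ _} {ys = ys} a∈xs a∈ys with DecMembership._∈?_ _≟_ x ys
... | yes x∈ = [] , -, -, refl , x∈ , λ ()
... | no x∉ with a∈xs
...   | here refl = contradiction a∈ys x∉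
...   | there a∈ with p , c , q , eq , c∈ , p∉ ← firstMeeting a∈ a∈ys =
  x ∷ p , c , q , cong (x ∷_) eq , c∈ , λ { (here refl) → x∉ ; (there z∈) → p∉ z∈ }

-- Forests and common refinements

-- Two walks that part at u close a cycle at the first vertex c of the one
-- that lies on the other: from c backwards to u, then forwards to c.
forest⇒walk-unique : NoClosed R → Forest R → Walk R u xs v → Walk R u ys v → xs ≡ ys
forest⇒walk-unique nc fo []      []      = refl
forest⇒walk-unique nc fo []      (r ∷ w) = contradiction r (nc w)
forest⇒walk-unique nc fo (r ∷ w) []      = contradiction r (nc w)
forest⇒walk-unique {R = R} {u = u} {v = v} nc fo
  w₁@(_∷_ {y = a} r₁ w₁′) w₂@(_∷_ {y = b} r₂ w₂′) with a ≟ b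
... | yes refl = cong (a ∷_) (forest⇒walk-unique nc fo w₁′ w₂′)
... | no a≢b with firstMeeting (end∈ w₁′) (end∈ w₂′)
...   | p , c , _ , eq , c∈ , p∉ with splitʷ w₂ c∈
...     | q , _ , eq′ , (_ , w₂″ , s₂) , _ = contradiction
  (c , reverse (u ∷ q) ++ p , long ,
    walk⇒linked (mapʷ bwd (reverseʷ w₂″ s₂) ++ʷ mapʷ fwd w₁″) (fwd s₁) ,
    ∉⇒unique c∉ (++⁺ (unique-reverse u∷q) p-unique disjoint)) fo
  where
  split₁ = splitAtʷ p (subst (λ l → Walk R u l v) eq w₁)
  w₁″ = proj₁ (proj₂ (proj₁ split₁))
  s₁  = proj₂ (proj₂ (proj₁ split₁))
  u∷xs = subst (λ l → Unique (u ∷ l)) eq (noClosed⇒unique nc w₁)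
  u∷ys = subst (λ l → Unique (u ∷ l)) eq′ (noClosed⇒unique nc w₂)
  u∷q  = unique-++⁻ˡ {xs = u ∷ q} u∷ys
  u∷p  = unique-++⁻ˡ {xs = u ∷ p} u∷xs
  p-unique : Unique p
  p-unique with _ ∷ un ← u∷p = un
  disjoint : ∀ {z} → ¬ (z ∈ reverse (u ∷ q) × z ∈ p)
  disjoint (z∈r , z∈p) with ∈-reverse⁻ {xs = u ∷ q} z∈r
  ... | here refl = unique⇒∉ u∷p z∈p
  ... | there z∈q = p∉ z∈p (subst (_ ∈_) (sym eq′) (∈-++⁺ˡ z∈q))
  c∉ : c ∉ reverse (u ∷ q) ++ p
  c∉ c∈ with ∈-++⁻ (reverse (u ∷ q)) c∈
  ... | inj₁ c∈r = split-∉ˡ (u ∷ q) u∷ys (∈-reverse⁻ {xs = u ∷ q} c∈r)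
  ... | inj₂ c∈p = split-∉ˡ (u ∷ p) u∷xs (there c∈p)
  -- If `p` and `q` were both empty, `c` would be both `a` and `b`. So the cycle has a third vertex
  -- besides `c` and `u`.
  nonempty : ∀ p q {r s t t′} → a ∷ r ≡ p ++ c ∷ s → b ∷ t ≡ q ++ c ∷ t′ → 1 ≤ length q + length p
  nonempty []      []      refl refl = contradiction refl a≢b
  nonempty (_ ∷ p) q       _    _    = ℕ.≤-trans (s≤s z≤n) (ℕ.m≤n+m _ (length q))
  nonempty []      (_ ∷ q) _    _    = s≤s z≤n
  long : 3 ≤ length (c ∷ reverse (u ∷ q) ++ p)
  long = s≤s (subst (2 ≤_)
    (sym (trans (length-++ (reverse (u ∷ q))) (cong (_+ length p) (length-reverse (u ∷ q)))))
    (s≤s (nonempty p q eq eq′)))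

last-⊆ : Walk R u (a ∷ xs) v → v ∷ ys ⊆ (a ∷ xs) ++ ys
last-⊆ {a = a} (r ∷ [])     = refl Sub.∷ Sub.⊆-refl
last-⊆ {a = a} (r ∷ s ∷ w) = a Sub.∷ʳ last-⊆ (s ∷ w)

module _ {n} {R : Rel (Fin n) 0ℓ} (R? : Decidable R) (nc : NoClosed R) where

  longPath? : ∀ u v → Dec (∃₂ (IsLongPath R u v))
  longPath? u v = map′
    (λ (_ , r , _ , s , w) → longPath⁺ nc r s w)
    (λ l → let _ , _ , r , s , w = longPath⁻ l in -, r , -, s , w)
    (any? λ x → R? u x ×-dec any? λ y → R? x y ×-dec reach? R? nc y v)

  -- An arc outside the reduction gives way to a long path with the same ends, so the old vertices
  -- survive in order and the walk grows.
  refineOnce : Walk R x xs y → Walk (TransitiveReduction R) x xs y ⊎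
    ∃[ ys ] Walk R x ys y × xs ⊆ ys × length xs < length ys
  refineOnce [] = inj₁ []
  refineOnce {x = x} (_∷_ {y = z} r w) with longPath? x z
  ... | yes l with _ , _ , s , t , _ , w′ ← longPath⁻ l =
    inj₂ (-, s ∷ ((t ∷ w′) ++ʷ w) , _ Sub.∷ʳ last-⊆ (t ∷ w′) , s≤s (length-mono-≤ (last-⊆ (t ∷ w′))))
  ... | no ¬l with refineOnce w
  ...   | inj₁ w′               = inj₁ ((r , ¬l) ∷ w′)
  ...   | inj₂ (_ , w′ , s , lt) = inj₂ (-, r ∷ w′ , refl Sub.∷ s , s≤s lt)

  -- `k` bounds the refinements still possible: each lengthens the walk, whose vertices stay
  -- distinct.
  refine′ : ∀ k → n ≤ length xs + k → Walk R x xs y →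
    ∃[ ys ] Walk (TransitiveReduction R) x ys y × xs ⊆ ys
  refine′ k le w with refineOnce w
  ... | inj₁ w′ = -, w′ , Sub.⊆-refl
  refine′ {xs = xs} zero le w | inj₂ _ =
    contradiction (unique-length (noClosed⇒unique nc w))
      (ℕ.<⇒≱ (s≤s (subst (n ≤_) (ℕ.+-identityʳ _) le)))
  refine′ {xs = xs} (suc k) le w | inj₂ (ys , w′ , s , lt) =
    let le′ = subst (_≤ length ys + k) (sym (ℕ.+-suc (length xs) k)) (ℕ.+-monoˡ-≤ k lt)
        _ , w″ , s′ = refine′ k (ℕ.≤-trans le le′) w′
    in -, w″ , Sub.⊆-trans s s′

  refine : Walk R x xs y → ∃[ ys ] Walk (TransitiveReduction R) x ys y × xs ⊆ ys
  refine {xs = xs} = refine′ n (ℕ.m≤n+m n (length xs))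

induced? : ∀ {n} {R : Rel (Fin n) 0ℓ} (U : Subset n) → Decidable R → Decidable (Induced U R)
induced? U R? x y = x ∈? U ×-dec y ∈? U ×-dec R? x y

induced-noClosed : {U : Subset n} → NoClosed R → NoClosed (Induced U R)
induced-noClosed = noClosed-map λ (_ , _ , r) → r

arc? : (D : Digraph n) → Decidable (Arc D)
arc? D _ _ = T? _

-- Tells for each vertex of a common refinement `qs` which of the two walks meets it, so that both
-- can be scanned in parallel.
data Cover : (us ws qs : List (Fin n)) → Set where
  []    : Cover {n} [] [] []
  left  : Cover us ws qs → Cover (x ∷ us) ws (x ∷ qs)
  right : Cover us ws qs → Cover us (x ∷ ws) (x ∷ qs)
  both  : Cover us ws qs → Cover (x ∷ us) (x ∷ ws) (x ∷ qs)

∈-tail : Unique (x ∷ qs) → a ∈ qs → a ∈ x ∷ us → a ∈ us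
∈-tail un a∈ (here refl) = contradiction a∈ (unique⇒∉ un)
∈-tail un _  (there a∈)  = a∈

-- A vertex skipped by both sublists still lies on one of them, hence occurs again later in `qs`,
-- against uniqueness.
cover : us ⊆ qs → ws ⊆ qs → Unique qs → (∀ {q} → q ∈ qs → q ∈ us ⊎ q ∈ ws) → Cover us ws qs
cover Sub.[] Sub.[] _ _ = []
cover (x Sub.∷ʳ s) (.x Sub.∷ʳ t) un c with c (here refl)
... | inj₁ x∈ = contradiction (Sub.lookup s x∈) (unique⇒∉ un)
... | inj₂ x∈ = contradiction (Sub.lookup t x∈) (unique⇒∉ un)
cover (refl Sub.∷ s) (_ Sub.∷ʳ t) un@(_ ∷ un′) c =
  left (cover s t un′ λ q∈ → Sum.map₁ (∈-tail un q∈) (c (there q∈)))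
cover (_ Sub.∷ʳ s) (refl Sub.∷ t) un@(_ ∷ un′) c =
  right (cover s t un′ λ q∈ → Sum.map₂ (∈-tail un q∈) (c (there q∈)))
cover (refl Sub.∷ s) (refl Sub.∷ t) un@(_ ∷ un′) c =
  both (cover s t un′ λ q∈ → Sum.map (∈-tail un q∈) (∈-tail un q∈) (c (there q∈)))

fromList : List (Fin n) → Subset n
fromList = foldr (λ x U → ⁅ x ⁆ ∪ U) ∅

∈-fromList⁺ : x ∈ xs → x ∈ˢ fromList xs
∈-fromList⁺ (here refl) = x∈p∪q⁺ (inj₁ (x∈⁅x⁆ _))
∈-fromList⁺ (there x∈)  = x∈p∪q⁺ (inj₂ (∈-fromList⁺ x∈))

∈-fromList⁻ : ∀ xs → x ∈ˢ fromList xs → x ∈ xs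
∈-fromList⁻ []       x∈ = contradiction x∈ ∉⊥
∈-fromList⁻ (y ∷ xs) x∈ with x∈p∪q⁻ ⁅ y ⁆ (fromList xs) x∈
... | inj₁ x∈y = here (x∈⁅y⁆⇒x≡y y x∈y)
... | inj₂ x∈xs = there (∈-fromList⁻ xs x∈xs)

induceʷ : {U : Subset n} → (∀ {z} → z ∈ x ∷ xs → z ∈ˢ U) → Walk R x xs y → Walk (Induced U R) x xs y
induceʷ ∈U []      = []
induceʷ ∈U (r ∷ w) = (∈U (here refl) , ∈U (there (here refl)) , r) ∷ induceʷ (∈U ∘ there) w

all∈ : {U : Subset n} → Walk R x xs y → (∀ {u v} → R u v → v ∈ˢ U) → ∀ {z} → z ∈ xs → z ∈ˢ U
all∈ (r ∷ w) f (here refl) = f r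
all∈ (r ∷ w) f (there z∈)  = all∈ w f z∈

-- The common refinement of two parallel walks in D exists since the reduction
-- of the subgraph induced by their vertices has a unique walk from u to v.
vertebrate⇒cover : {D : Digraph n} → NoClosed (Arc D) → Vertebrate D →
  Walk (Arc D) u us v → Walk (Arc D) u ws v →
  ∃[ qs ] Walk (Arc D) u qs v × Cover us ws qs
vertebrate⇒cover {u = u} {us = us} {v = v} {ws = ws} {D = D} nc vert w₁ w₂ =
  parallel (refine I? I-noClosed (induceʷ (∈-fromList⁺ ∘ in₁) w₁))
    (refine I? I-noClosed (induceʷ (∈-fromList⁺ ∘ in₂) w₂))
  where
  V = u ∷ us ++ ws
  U = fromList V
  I = Induced U (Arc D)
  I? = induced? U (arc? D)
  I-noClosed : NoClosed I
  I-noClosed = induced-noClosed nc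
  in₁ : ∀ {z} → z ∈ u ∷ us → z ∈ V
  in₁ (here eq)  = here eq
  in₁ (there z∈) = there (∈-++⁺ˡ z∈)
  in₂ : ∀ {z} → z ∈ u ∷ ws → z ∈ V
  in₂ (here eq)  = here eq
  in₂ (there z∈) = there (∈-++⁺ʳ us z∈)
  parallel : (∃[ qs ] Walk (TransitiveReduction I) u qs v × us ⊆ qs) →
    (∃[ qs ] Walk (TransitiveReduction I) u qs v × ws ⊆ qs) →
    ∃[ qs ] Walk (Arc D) u qs v × Cover us ws qs
  parallel (qs , w , s) (_ , w′ , t)
    with refl ← forest⇒walk-unique (noClosed-map proj₁ I-noClosed) (vert U) w w′
    with un@(_ ∷ un′) ← noClosed⇒unique I-noClosed (mapʷ proj₁ w) =
    -, mapʷ (λ ((_ , _ , d) , _) → d) w , cover s t un′ covered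
    where
    covered : ∀ {q} → q ∈ qs → q ∈ us ⊎ q ∈ ws
    covered q∈ with ∈-fromList⁻ V (all∈ w (λ ((_ , v∈ , _) , _) → v∈) q∈)
    ... | here refl = contradiction q∈ (unique⇒∉ un)
    ... | there q∈′ = ∈-++⁻ us q∈′

-- Reorientations

Reorient : Rel (Fin n) 0ℓ → Rel (Fin n) 0ℓ → Rel (Fin n) 0ℓ
Reorient R r u v = R u v × ¬ r u v ⊎ R v u × r v u

reorient-asym : Asymmetric R → Asymmetric (Reorient R S)
reorient-asym asym (inj₁ (d , _))  (inj₁ (d′ , _)) = asym d d′
reorient-asym asym (inj₁ (_ , ¬r)) (inj₂ (_ , r))  = ¬r r
reorient-asym asym (inj₂ (_ , r))  (inj₁ (_ , ¬r)) = ¬r r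
reorient-asym asym (inj₂ (d , _))  (inj₂ (d′ , _)) = asym d d′

symClosure-flip : SymClosure R ⇒ SymClosure (flip R)
symClosure-flip (fwd r) = bwd r
symClosure-flip (bwd r) = fwd r

module _ {n} (D : Digraph n) (D-simple : Simple D) where

  module _ {r : Rel (Fin n) 0ℓ} (r? : Decidable r) where

    reorient? : Decidable (Reorient (Arc D) r)
    reorient? u v = (arc? D u v ×-dec ¬? (r? u v)) ⊎-dec (arc? D v u ×-dec r? v u)

    reorientGraph : Digraph n
    reorientGraph = digraph λ u v → ⌊ reorient? u v ⌋

    arc⁻ : Arc reorientGraph u v → Reorient (Arc D) r u v
    arc⁻ {u} {v} = toWitness {a? = reorient? u v}

    arc⁺ : Reorient (Arc D) r u v → Arc reorientGraph u v
    arc⁺ {u} {v} = fromWitness {a? = reorient? u v}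

    reorientGraph-simple : Simple reorientGraph
    reorientGraph-simple = record
      { loopless = λ { refl e → asym e e }
      ; oneArc   = asym
      }
      where
      asym : Asymmetric (Arc reorientGraph)
      asym e e′ = reorient-asym {S = r} (Simple.oneArc D-simple) (arc⁻ e) (arc⁻ e′)

    reorient : NoClosed (Reorient (Arc D) r) → AcyclicReorientation D
    reorient nc = record
      { graph           = reorientGraph
      ; isReorientation = record
        { simple    = reorientGraph-simple
        ; sameEdges = to , from
        }
      ; acyclic         = noClosed⇒acyclic (noClosed-map arc⁻ nc)
      }
      where
      to : SymClosure (Arc D) ⇒ SymClosure (Arc reorientGraph)
      to {u} {v} (fwd d) with r? u v
      ... | no ¬r = fwd (arc⁺ (inj₁ (d , ¬r)))
      ... | yes r = bwd (arc⁺ (inj₂ (d , r)))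
      to {u} {v} (bwd d) with r? v u
      ... | no ¬r = bwd (arc⁺ (inj₁ (d , ¬r)))
      ... | yes r = fwd (arc⁺ (inj₂ (d , r)))
      from : SymClosure (Arc reorientGraph) ⇒ SymClosure (Arc D)
      from (fwd e) with arc⁻ e
      ... | inj₁ (d , _) = fwd d
      ... | inj₂ (d , _) = bwd d
      from (bwd e) with arc⁻ e
      ... | inj₁ (d , _) = bwd d
      ... | inj₂ (d , _) = fwd d

    reversed⁺ : Arc D u v → r u v → Reversed D reorientGraph u v
    reversed⁺ d p = d , arc⁺ (inj₂ (d , p))

    reversed⁻ : Reversed D reorientGraph u v → r u v
    reversed⁻ (d , e) with arc⁻ e
    ... | inj₁ (d′ , _) = contradiction d′ (Simple.oneArc D-simple d)
    ... | inj₂ (_ , p)  = p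

-- A walk that has entered `U` cannot leave it, so a closed walk lies entirely inside or entirely
-- outside `U`.
noClosed-split : (U : Subset n) →
  (∀ {u v} → R u v → u ∈ˢ U → v ∈ˢ U) →
  NoClosed (Induced U R) → NoClosed (λ u v → u ∉ˢ U × v ∉ˢ U × R u v) → NoClosed R
noClosed-split {R = R} U closed in-U out-U {x} {_} {y} w r with x ∈? U
... | yes x∈ = in-U (inside x∈ w) (stays x∈ w , x∈ , r)
  where
  stays : ∀ {x xs y} → x ∈ˢ U → Walk R x xs y → y ∈ˢ U
  stays x∈ []      = x∈
  stays x∈ (r ∷ w) = stays (closed r x∈) w
  inside : ∀ {x xs y} → x ∈ˢ U → Walk R x xs y → Walk (Induced U R) x xs y
  inside x∈ []      = []
  inside x∈ (r ∷ w) = (x∈ , closed r x∈ , r) ∷ inside (closed r x∈) w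
... | no x∉ = out-U (proj₂ (outside w y∉)) (y∉ , x∉ , r)
  where
  y∉ : y ∉ˢ U
  y∉ = x∉ ∘ closed r
  outside : ∀ {x xs} → Walk R x xs y → y ∉ˢ U →
    x ∉ˢ U × Walk (λ u v → u ∉ˢ U × v ∉ˢ U × R u v) x xs y
  outside []      y∉ = y∉ , []
  outside (r ∷ w) y∉ = let v∉ , w′ = outside w y∉ in v∉ ∘ closed r , (v∉ ∘ closed r , v∉ , r) ∷ w′

AddArc : Fin n → Fin n → Rel (Fin n) 0ℓ → Rel (Fin n) 0ℓ
AddArc a b R u v = R u v ⊎ u ≡ a × v ≡ b

-- A closed walk through the new arc contains a walk of `R` from `b` back to `a`. To find it, `cut`
-- keeps what precedes the first use of the arc and what follows the last.
noClosed-addArc : NoClosed R → ¬ Reach R b a → NoClosed (AddArc a b R)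
noClosed-addArc {R = R} {b = b} {a = a} nc ¬ba w r = closing (cut w) r
  where
  cut : ∀ {x xs y} → Walk (AddArc a b R) x xs y → Reach R x y ⊎ Reach R x a × Reach R b y
  cut [] = inj₁ (-, [])
  cut (inj₁ r ∷ w) with cut w
  ... | inj₁ (_ , w₁)        = inj₁ (-, r ∷ w₁)
  ... | inj₂ ((_ , w₁) , by) = inj₂ ((-, r ∷ w₁) , by)
  cut (inj₂ (refl , refl) ∷ w) with cut w
  ... | inj₁ by       = inj₂ ((-, []) , by)
  ... | inj₂ (_ , by) = inj₂ ((-, []) , by)
  closing : ∀ {x y} → Reach R x y ⊎ Reach R x a × Reach R b y → ¬ AddArc a b R y x
  closing (inj₁ (_ , xy))              (inj₁ r)             = nc xy r
  closing (inj₁ xy)                    (inj₂ (refl , refl)) = ¬ba xy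
  closing (inj₂ ((_ , xa) , (_ , by))) (inj₁ r)             = ¬ba (-, by ++ʷ (r ∷ xa))
  closing (inj₂ (_ , by))              (inj₂ (refl , _))    = ¬ba by

RemoveArc : Fin n → Fin n → Rel (Fin n) 0ℓ → Rel (Fin n) 0ℓ
RemoveArc a b R u v = R u v × ¬ (u ≡ a × v ≡ b)

-- A walk from `a` to `b` is empty, a single arc or a long path. This is why an arc of the reduction
-- can be reversed alone.
reduction⇒¬reach : NoClosed R → TransitiveReduction R a b → ¬ Reach (RemoveArc a b R) a b
reduction⇒¬reach nc (r , _)  (_ , [])                 = nc [] r
reduction⇒¬reach nc _        (_ , (_ , ≢ab) ∷ [])     = ≢ab (refl , refl)
reduction⇒¬reach nc (_ , ¬l) (_ , (r , _) ∷ (s , _) ∷ w) =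
  ¬l (longPath⁺ nc r s (-, mapʷ proj₁ w))

-- Consecutive vertices of a cycle

data Consecutive (a b : Fin n) : List (Fin n) → Set where
  here  : Consecutive a b (a ∷ b ∷ xs)
  there : Consecutive a b xs → Consecutive a b (x ∷ xs)

consecutive⇒∈ˡ : Consecutive a b xs → a ∈ xs
consecutive⇒∈ˡ here      = here refl
consecutive⇒∈ˡ (there c) = there (consecutive⇒∈ˡ c)

consecutive⇒∈ʳ : Consecutive a b (x ∷ xs) → b ∈ xs
consecutive⇒∈ʳ here              = here refl
consecutive⇒∈ʳ (there {xs = _ ∷ _} c) = there (consecutive⇒∈ʳ c)

consecutive-asym : Unique xs → Consecutive a b xs → ¬ Consecutive b a xs
consecutive-asym un       here      here       = unique⇒∉ un (here refl)
consecutive-asym un       here      (there c)  = unique⇒∉ un (there (consecutive⇒∈ʳ c))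
consecutive-asym un       (there c) here       = unique⇒∉ un (there (consecutive⇒∈ʳ c))
consecutive-asym (_ ∷ un) (there c) (there c′) = consecutive-asym un c c′

unique-∷ʳ : Unique (x ∷ xs) → Unique (xs ∷ʳ x)
unique-∷ʳ un@(_ ∷ un′) = ++⁺ un′ ([] ∷ []) λ { (x∈ , here refl) → unique⇒∉ un x∈ }

closed-second : Unique (x ∷ a ∷ b ∷ xs) → ¬ Consecutive a x (a ∷ b ∷ xs ∷ʳ x)
closed-second un here = unique⇒∉ un (there (here refl))
closed-second {b = b} {xs = xs} un@(_ ∷ un′) (there c) with ∈-++⁻ (b ∷ xs) (consecutive⇒∈ˡ c)
... | inj₁ a∈          = unique⇒∉ un′ a∈
... | inj₂ (here refl) = unique⇒∉ un (here refl)

-- The closed walk x, y, x traverses its edge both ways, hence the length bound. Dropping the first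
-- vertex leaves `xs ∷ʳ x`, again without repetitions, so only the first edge needs separate care.
closedConsecutive-asym : Unique (x ∷ xs) → 3 ≤ length (x ∷ xs) →
  Consecutive a b (x ∷ xs ∷ʳ x) → ¬ Consecutive b a (x ∷ xs ∷ʳ x)
closedConsecutive-asym {xs = []}        un (s≤s ())
closedConsecutive-asym {xs = _ ∷ []}    un (s≤s (s≤s ()))
closedConsecutive-asym {xs = _ ∷ _ ∷ _} un _ here      here       = unique⇒∉ un (here refl)
closedConsecutive-asym {xs = _ ∷ _ ∷ _} un _ here      (there c)  = closed-second un c
closedConsecutive-asym {xs = _ ∷ _ ∷ _} un _ (there c) here       = closed-second un c
closedConsecutive-asym {xs = _ ∷ _ ∷ _} un _ (there c) (there c′) = consecutive-asym (unique-∷ʳ un) c c′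

-- Lattices come from vertebrate digraphs only

module _ {n} (D : Digraph n) (D-simple : Simple D) (D-acyclic : Acyclic (Arc D)) where

  private
    D-noClosed : NoClosed (Arc D)
    D-noClosed = acyclic⇒noClosed D-acyclic
    open AcyclicReorientation

    bottom : AcyclicReorientation D
    bottom = record
      { graph = D
      ; isReorientation = record { simple = D-simple ; sameEdges = id , id }
      ; acyclic = D-acyclic
      }

    bottom-least : ∀ E → _≤ᴬᴿ_ D bottom E
    bottom-least E (d , e) = contradiction e (Simple.oneArc D-simple d)

  module _ (U : Subset n) where

    Dᵁ : Rel (Fin n) 0ℓ
    Dᵁ = Induced U (Arc D)

    Dᵁ-noClosed : NoClosed Dᵁ
    Dᵁ-noClosed = induced-noClosed D-noClosed

    -- Reversing all arcs that leave U makes any acyclic reorientation of the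
    -- subgraph induced by U extend to D, whatever the vertices outside U.
    FlipOne FlipAllBut : Fin n → Fin n → Rel (Fin n) 0ℓ
    FlipOne    a b u v = u ∈ˢ U × v ∉ˢ U ⊎ u ≡ a × v ≡ b
    FlipAllBut a b u v = u ∈ˢ U × ¬ (u ≡ a × v ≡ b)

    flipOne? : ∀ a b → Decidable (FlipOne a b)
    flipOne? a b u v = (u ∈? U ×-dec ¬? (v ∈? U)) ⊎-dec (u ≟ a ×-dec v ≟ b)

    flipAllBut? : ∀ a b → Decidable (FlipAllBut a b)
    flipAllBut? a b u v = u ∈? U ×-dec ¬? (u ≟ a ×-dec v ≟ b)

    module _ {a b} (ab : TransitiveReduction Dᵁ a b) where

      private
        a∈ : a ∈ˢ U
        a∈ = proj₁ (proj₁ ab)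
        b∈ : b ∈ˢ U
        b∈ = proj₁ (proj₂ (proj₁ ab))

        removed-noClosed : NoClosed (RemoveArc a b Dᵁ)
        removed-noClosed = noClosed-map proj₁ Dᵁ-noClosed

      -- No arc leaves `U` any more. Inside `U`, the arc b → a replaces a → b; a closed walk through
      -- it would contain a second walk from `a` to `b`, which the reduction excludes.
      flipOne-noClosed : NoClosed (Reorient (Arc D) (FlipOne a b))
      flipOne-noClosed = noClosed-split U closed
        (noClosed-map inside (noClosed-addArc removed-noClosed (reduction⇒¬reach Dᵁ-noClosed ab)))
        (noClosed-map outside D-noClosed)
        where
        closed : ∀ {u v} → Reorient (Arc D) (FlipOne a b) u v → u ∈ˢ U → v ∈ˢ U
        closed {v = v} (inj₁ (_ , ¬r)) u∈ with v ∈? U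
        ... | yes v∈ = v∈
        ... | no v∉  = contradiction (inj₁ (u∈ , v∉)) ¬r
        closed (inj₂ (_ , inj₁ (v∈ , _)))  _ = v∈
        closed (inj₂ (_ , inj₂ (refl , _))) _ = a∈
        inside : Induced U (Reorient (Arc D) (FlipOne a b)) ⇒ AddArc b a (RemoveArc a b Dᵁ)
        inside (u∈ , v∈ , inj₁ (d , ¬r))                   = inj₁ ((u∈ , v∈ , d) , ¬r ∘ inj₂)
        inside (u∈ , v∈ , inj₂ (_ , inj₁ (_ , u∉)))        = contradiction u∈ u∉
        inside (u∈ , v∈ , inj₂ (_ , inj₂ (refl , refl)))   = inj₂ (refl , refl)
        outside : (λ u v → u ∉ˢ U × v ∉ˢ U × Reorient (Arc D) (FlipOne a b) u v) ⇒ Arc D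
        outside (_ , _ , inj₁ (d , _))                     = d
        outside (_ , v∉ , inj₂ (_ , inj₁ (v∈ , _)))        = contradiction v∈ v∉
        outside (_ , v∉ , inj₂ (_ , inj₂ (refl , refl)))   = contradiction a∈ v∉

      -- As for `flipOne-noClosed`, with `U` turned around: a closed walk through a → b contains a
      -- walk from `b` to `a`, which read backwards is a second walk from `a` to `b`.
      flipAllBut-noClosed : NoClosed (Reorient (Arc D) (FlipAllBut a b))
      flipAllBut-noClosed = noClosed-split U closed
        (noClosed-map inside (noClosed-addArc (noClosed-flip removed-noClosed)
          λ (_ , w) → reduction⇒¬reach Dᵁ-noClosed ab (flipʷ w)))
        (noClosed-map outside D-noClosed)
        where
        closed : ∀ {u v} → Reorient (Arc D) (FlipAllBut a b) u v → u ∈ˢ U → v ∈ˢ U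
        closed {u} {v} (inj₁ (_ , ¬r)) u∈ with u ≟ a ×-dec v ≟ b
        ... | yes (_ , refl) = b∈
        ... | no ≢ab         = contradiction (u∈ , ≢ab) ¬r
        closed (inj₂ (_ , v∈ , _)) _ = v∈
        inside : Induced U (Reorient (Arc D) (FlipAllBut a b)) ⇒ AddArc a b (flip (RemoveArc a b Dᵁ))
        inside {u} {v} (u∈ , v∈ , inj₁ (d , ¬r)) with u ≟ a ×-dec v ≟ b
        ... | yes eqs = inj₂ eqs
        ... | no ≢ab  = contradiction (u∈ , ≢ab) ¬r
        inside (u∈ , v∈ , inj₂ (d , _ , ≢ab)) = inj₁ ((v∈ , u∈ , d) , ≢ab)
        outside : (λ u v → u ∉ˢ U × v ∉ˢ U × Reorient (Arc D) (FlipAllBut a b) u v) ⇒ Arc D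
        outside (_ , _ , inj₁ (d , _))       = d
        outside (_ , v∉ , inj₂ (_ , v∈ , _)) = contradiction v∈ v∉

      flipOne flipAllBut : AcyclicReorientation D
      flipOne    = reorient D D-simple (flipOne? a b) flipOne-noClosed
      flipAllBut = reorient D D-simple (flipAllBut? a b) flipAllBut-noClosed

    -- An arc leaving `U` cannot be c → d, whose head lies in `U`. The comparison keeps a join of
    -- single reversals from reversing c → d.
    flipOne≤flipAllBut : ∀ {a b c d} (ab : TransitiveReduction Dᵁ a b) (cd : TransitiveReduction Dᵁ c d) →
      ¬ (a ≡ c × b ≡ d) → _≤ᴬᴿ_ D (flipOne ab) (flipAllBut cd)
    flipOne≤flipAllBut {a} {b} {c} {d} ab cd ≢cd {u} {v} r =
      reversed⁺ D D-simple (flipAllBut? c d) (proj₁ r) (imp (reversed⁻ D D-simple (flipOne? a b) r))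
      where
      imp : FlipOne a b u v → FlipAllBut c d u v
      imp (inj₁ (u∈ , v∉))     = u∈ , λ { (_ , refl) → v∉ (proj₁ (proj₂ (proj₁ cd))) }
      imp (inj₂ (refl , refl)) = proj₁ (proj₁ ab) , ≢cd

  lattice⇒vertebrate : IsLatticePoset (AcyclicReorientationPoset D) → Vertebrate D
  lattice⇒vertebrate (_∨_ , _ , isLattice) U (x , xs , 3≤ , linked , un) =
    acyclic M (x , xs , cycle linked id id , un)
    where
    open IsLattice isLattice using (supremum)
    T = TransitiveReduction (Dᵁ U)

    joinBwd : ∀ {xs} → Linked (SymClosure T) xs → AcyclicReorientation D
    joinBwd []          = bottom
    joinBwd [-]         = bottom
    joinBwd (fwd _ ∷ l) = joinBwd l
    joinBwd (bwd t ∷ l) = flipOne U t ∨ joinBwd l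

    joinBwd-least : ∀ {xs} (l : Linked (SymClosure T) xs) (H : AcyclicReorientation D) →
      (∀ {a b} → Consecutive a b xs → (t : T b a) → _≤ᴬᴿ_ D (flipOne U t) H) → _≤ᴬᴿ_ D (joinBwd l) H
    joinBwd-least []  H _ = bottom-least H
    joinBwd-least [-] H _ = bottom-least H
    joinBwd-least (fwd _ ∷ l) H le = joinBwd-least l H (le ∘ there)
    joinBwd-least (bwd t ∷ l) H le =
      proj₂ (proj₂ (supremum (flipOne U t) (joinBwd l))) H (le here t) (joinBwd-least l H (le ∘ there))

    M : AcyclicReorientation D
    M = joinBwd linked

    -- Induction on the suffixes `ys` of the cycle. The hypotheses retain that the edges of `ys`
    -- belong to the cycle and that the join of its backward arcs lies below `M`.
    cycle : ∀ {ys} (l : Linked (SymClosure T) ys) →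
      (∀ {a b} → Consecutive a b ys → Consecutive a b (x ∷ xs ∷ʳ x)) →
      (∀ {u v} → Reversed D (graph (joinBwd l)) u v → Reversed D (graph M) u v) → Linked (Arc (graph M)) ys
    cycle []  _ _ = []
    cycle [-] _ _ = [-]
    cycle (_∷_ {a} {b} (fwd t) l) c ≤M with proj₁ (sameEdges M) (fwd (proj₂ (proj₂ (proj₁ t))))
    ... | fwd ab = ab ∷ cycle l (c ∘ there) ≤M
    -- Had `M` reversed the forward arc `t`, so would `flipAllBut U t`, which is above all the
    -- single reversals: a backward arc equal to `t` would be an edge traversed both ways.
    ... | bwd ba = contradiction (refl , refl) (proj₂ (reversed⁻ D D-simple (flipAllBut? U a b)
      (joinBwd-least linked (flipAllBut U t)
        (λ c′ t′ → flipOne≤flipAllBut U t′ t λ { (refl , refl) → closedConsecutive-asym un 3≤ (c here) c′ })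
        (proj₂ (proj₂ (proj₁ t)) , ba))))
    cycle (bwd t ∷ l) c ≤M with supremum (flipOne U t) (joinBwd l)
    ... | ≤₁ , ≤₂ , _ =
      proj₂ (≤M (≤₁ (reversed⁺ D D-simple (flipOne? U _ _) (proj₂ (proj₂ (proj₁ t))) (inj₂ (refl , refl)))))
        ∷ cycle l (c ∘ there) (≤M ∘ ≤₂)

  -- Joins for vertebrate digraphs

  module _ (vert : Vertebrate D) (E F : AcyclicReorientation D) where

    private
      E-noClosed : NoClosed (Arc (graph E))
      E-noClosed = acyclic⇒noClosed (acyclic E)
      F-noClosed : NoClosed (Arc (graph F))
      F-noClosed = acyclic⇒noClosed (acyclic F)

    -- `G` is the candidate for the join. It reverses the arcs of `D` in `Z`, the reflexive
    -- transitive closure of `P`, and keeps those in `N`.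
    P Z N G : Rel (Fin n) 0ℓ
    P u v = Reversed D (graph E) u v ⊎ Reversed D (graph F) u v
    Z     = Reach P
    N u v = Arc D u v × ¬ Z u v
    G     = Reorient (Arc D) Z

    P⇒D : P ⇒ Arc D
    P⇒D (inj₁ (d , _)) = d
    P⇒D (inj₂ (d , _)) = d

    P? : Decidable P
    P? u v = (arc? D u v ×-dec arc? (graph E) v u) ⊎-dec (arc? D u v ×-dec arc? (graph F) v u)

    Z? : Decidable Z
    Z? = reach? P? (noClosed-map P⇒D D-noClosed)

    kept : ∀ (H : AcyclicReorientation D) → Arc D u v → ¬ Reversed D (graph H) u v → Arc (graph H) u v
    kept H d ¬r with proj₁ (sameEdges H) (fwd d)
    ... | fwd e = e
    ... | bwd e = contradiction (d , e) ¬r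

    kept-E : Arc D u v → ¬ P u v → Arc (graph E) u v
    kept-E d ¬p = kept E d (¬p ∘ inj₁)
    kept-F : Arc D u v → ¬ P u v → Arc (graph F) u v
    kept-F d ¬p = kept F d (¬p ∘ inj₂)

    N⇒¬P : N u v → ¬ P u v
    N⇒¬P (_ , ¬z) p = ¬z (-, p ∷ [])

    -- A cover is scanned from u to v, where x is the last vertex of the P-walk met
    -- so far.  In scan-P no vertex of the N-walk has been met after x, and u ⇝ x
    -- in P.  In scan-N the vertex c of the N-walk has been met after x, and E and F
    -- both keep a walk x ⇝ c; hence reversing the P-arc x → w′ that jumps over c
    -- forces the reversal of c → w′.
    scan-P : Cover us ws qs → u ≢ v → Z u x →
      Walk N u us v → Walk P x ws v → Walk (Arc D) x qs v → ⊥
    scan-N : Cover us ws qs → x ≢ c → Reach (Arc (graph E)) x c → Reach (Arc (graph F)) x c →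
      Walk N c us v → Walk P x ws v → Walk (Arc D) c qs v → ⊥

    -- The disequalities carried along make it absurd that both walks run out.
    scan-P []        u≢v _ [] _ _ = u≢v refl
    scan-P (both _)  _ (_ , w) ((_ , ¬z) ∷ _) (p ∷ _) _ = ¬z (-, w ++ʷ (p ∷ []))
    scan-P (right k) u≢v (_ , w) ns (p ∷ ps) (_ ∷ qs) = scan-P k u≢v (-, w ++ʷ (p ∷ [])) ns ps qs
    scan-P {u = u} {x = x} (left {x = c} k) _ (_ , w) ((_ , ¬z) ∷ ns) ps (q ∷ qs) =
      scan-N k (noClosed⇒≢ D-noClosed q) (-, kept-E q ¬p ∷ []) (-, kept-F q ¬p ∷ []) ns ps qs
      where
      -- A `P`-arc x → c would extend the `P`-walk u ⇝ x to `c`, although the `N`-walk starts with u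
      -- → c.
      ¬p : ¬ P x c
      ¬p p = ¬z (-, w ++ʷ (p ∷ []))

    scan-N []       x≢c _ _ [] [] _ = x≢c refl
    scan-N (left k) _ (_ , e) (_ , f) (n@(d , _) ∷ ns) ps (_ ∷ qs) =
      scan-N k (λ { refl → E-noClosed e (kept-E d (N⇒¬P n)) })
        (-, e ++ʷ (kept-E d (N⇒¬P n) ∷ [])) (-, f ++ʷ (kept-F d (N⇒¬P n) ∷ [])) ns ps qs
    -- The `P`-walk jumps from `x` to the very vertex that follows `c` on the `N`-walk. The kept
    -- walk from `x` to it closes a cycle with the reversed arc, in `E` or in `F`.
    scan-N (both k) _ (_ , e) _ (n@(d , _) ∷ _) (inj₁ (_ , r) ∷ _) _ =
      E-noClosed (e ++ʷ (kept-E d (N⇒¬P n) ∷ [])) r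
    scan-N (both k) _ _ (_ , f) (n@(d , _) ∷ _) (inj₂ (_ , r) ∷ _) _ =
      F-noClosed (f ++ʷ (kept-F d (N⇒¬P n) ∷ [])) r
    scan-N {c = c} {v = v} (right {x = w′} k) _ (_ , e) (_ , f) ns (p ∷ ps) (q ∷ qs) =
      scan-P k (λ { refl → D-noClosed qs q }) (-, forced p ∷ []) ns ps qs
      where
      forced : P _ w′ → P c w′
      forced (inj₁ (_ , r)) with proj₁ (sameEdges E) (fwd q)
      ... | fwd cw′ = contradiction r (E-noClosed (e ++ʷ (cw′ ∷ [])))
      ... | bwd w′c = inj₁ (q , w′c)
      forced (inj₂ (_ , r)) with proj₁ (sameEdges F) (fwd q)
      ... | fwd cw′ = contradiction r (F-noClosed (f ++ʷ (cw′ ∷ [])))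
      ... | bwd w′c = inj₂ (q , w′c)

    N-walk⇒¬Z : u ≢ v → Walk N u us v → ¬ Z u v
    N-walk⇒¬Z u≢v ns (_ , ps) =
      let _ , qs , k = vertebrate⇒cover D-noClosed vert (mapʷ proj₁ ns) (mapʷ P⇒D ps)
      in scan-P k u≢v (-, []) ns ps qs

    G-asym : Asymmetric G
    G-asym = reorient-asym {S = Z} (Simple.oneArc D-simple)

    -- `L` does not count the closing arc. The assumption is the induction hypothesis of
    -- `G-noClosed′`.
    module ShortestCycle {L : ℕ}
      (no-shorter : ∀ {x xs y} → length xs < L → Walk G x xs y → ¬ G y x) where

      no-shorter⇒unique : length xs ≤ L → Walk G x xs y → Unique (x ∷ xs)
      no-shorter⇒unique le w with walk-unique w
      ... | inj₁ un = un
      ... | inj₂ (_ , _ , _ , w′ , s , _ , lt) = contradiction s (no-shorter (ℕ.<-≤-trans lt le) w′)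

      -- The disjunction excludes a = x, b = y, where the edge is not a chord but
      -- closes the cycle.
      no-chord : Walk G x xs a → Walk G a (z ∷ zs) y → G y x → length xs + length (z ∷ zs) ≡ L →
        length (z ∷ zs) < L ⊎ b ≢ y → b ∈ zs → ¬ SymClosure G a b
      no-chord {xs = xs} {z = z} {b = b} w₀ (g ∷ w) yx len _ b∈ (fwd ab)
        with p , q , refl , _ , w₂ ← splitʷ w b∈ =
        no-shorter lt (w₀ ++ʷ (ab ∷ w₂)) yx
        where
        lt : length (xs ++ b ∷ q) < L
        lt = subst₂ _<_ (sym (length-++ xs)) len
          (ℕ.+-monoʳ-< (length xs) (s≤s (length-++-≤ʳ (b ∷ q) {p})))
      -- The chord b → a closes up the part of the cycle from `a` to `b`. It is shorter than the
      -- cycle unless `w₀` is empty and b = y, which `short` excludes.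
      no-chord {xs = xs} {z = z} {y = y} {b = b} w₀ (g ∷ w) yx len short b∈ (bwd ba)
        with p , q , refl , (_ , w₁ , s) , w₂ ← splitʷ w b∈ =
        no-shorter (lt w₂ (subst (length (z ∷ p ++ b ∷ q) ≤_) len (ℕ.m≤n+m _ (length xs))) short)
          (g ∷ (w₁ ++ʷ (s ∷ []))) ba
        where
        suffix-< : ∀ {q r} → length q < length r → length (p ++ q) < length (p ++ r)
        suffix-< lt = subst₂ _<_ (sym (length-++ p)) (sym (length-++ p)) (ℕ.+-monoʳ-< (length p) lt)
        lt : ∀ {q} → Walk G b q y → length (z ∷ p ++ b ∷ q) ≤ L →
          length (z ∷ p ++ b ∷ q) < L ⊎ b ≢ y → length (z ∷ p ∷ʳ b) < L
        lt []      _  (inj₁ <L)  = <L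
        lt []      _  (inj₂ b≢y) = contradiction refl b≢y
        lt (_ ∷ _) ≤L _          = ℕ.<-≤-trans (s≤s (suffix-< (s≤s (s≤s z≤n)))) ≤L

      -- Without chords, a B-walk inside the cycle cannot but follow it.
      follow : {B : Rel (Fin n) 0ℓ} → NoClosed B → (B ⇒ SymClosure G) →
        Unique (a ∷ zs) → Walk G x xs a → Walk G a zs y → G y x → length xs + length zs ≡ L →
        Walk B a ws y → (∀ {w} → w ∈ ws → w ∈ zs) →
        (∀ {w ws′} → ws ≡ w ∷ ws′ → length zs < L ⊎ w ≢ y) → Walk B a zs y
      follow nc B⇒G un w₀ [] yx len [] _ _ = []
      follow nc B⇒G un w₀ [] yx len (r ∷ ws) ⊆zs _ with () ← ⊆zs (here refl)
      follow nc B⇒G un w₀ (g ∷ w) yx len [] _ _ = contradiction (end∈ w) (unique⇒∉ un)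
      follow {zs = z ∷ zs} {xs = xs} nc B⇒G un@(_ ∷ un′) w₀ (g ∷ w) yx len (r ∷ ws) ⊆zs short with ⊆zs (here refl)
      ... | there b∈ = contradiction (B⇒G r) (no-chord w₀ (g ∷ w) yx len (short refl) b∈)
      ... | here refl = r ∷ follow nc B⇒G un′ (w₀ ++ʷ (g ∷ [])) w yx
        (trans (cong (_+ length zs) (length-++ xs)) (trans (ℕ.+-assoc (length xs) 1 _) len)) ws
        (λ w∈ → ∈-tail (noClosed⇒unique nc ws) w∈ (⊆zs (there w∈)))
        -- After the first step less than the whole cycle remains, so no later edge can be the
        -- closing one.
        λ _ → inj₁ (subst (suc (length zs) ≤_) len (ℕ.m≤n+m _ (length xs)))

      module _ (U : Subset n) where

        private
          I : Rel (Fin n) 0ℓ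
          I = Induced U (Arc D)
          I-noClosed : NoClosed I
          I-noClosed = induced-noClosed D-noClosed
          I? = induced? U (arc? D)

        I⇒G : I ⇒ SymClosure G
        I⇒G {u} {v} (_ , _ , d) with Z? u v
        ... | yes z = bwd (inj₂ (d , z))
        ... | no ¬z = fwd (inj₁ (d , ¬z))

        along-Z : Walk G x xs y → Walk (flip I) x xs y → Z y x
        along-Z []                []                     = -, []
        along-Z (inj₂ (_ , _ , z) ∷ w) (_ ∷ w′)          = -, proj₂ (along-Z w w′) ++ʷ z
        along-Z (inj₁ (d , _) ∷ w) ((_ , _ , d′) ∷ w′)   = contradiction d (Simple.oneArc D-simple d′)

        along-N : Walk G x xs y → Walk I x xs y → Walk N x xs y
        along-N []            []                         = []
        along-N (inj₁ n ∷ w)  (_ ∷ w′)                   = n ∷ along-N w w′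
        along-N (inj₂ (d , _) ∷ w) ((_ , _ , d′) ∷ w′)   = contradiction d (Simple.oneArc D-simple d′)

        -- A long path of `I` between the ends of the closing arc has an interior vertex, so it does
        -- not start with that arc, and `follow` makes it run through the whole cycle.
        closing-arc : Walk G x xs y → G y x → length xs ≡ L →
          x ∈ˢ U → y ∈ˢ U → (∀ {z} → z ∈ˢ U → z ∈ x ∷ xs) →
          SymClosure (TransitiveReduction I) y x
        closing-arc {x = x} {xs = xs} {y = y} w yx len x∈ y∈ U⊆ = go yx
          where
          un : Unique (x ∷ xs)
          un = no-shorter⇒unique (ℕ.≤-reflexive len) w
          within : ∀ {B : Rel (Fin n) 0ℓ} {ws} → NoClosed B → (∀ {u v} → B u v → v ∈ˢ U) →
            Walk B x ws y → ∀ {z} → z ∈ ws → z ∈ xs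
          within nc ⇒∈U w z∈ = ∈-tail (noClosed⇒unique nc w) z∈ (U⊆ (all∈ w ⇒∈U z∈))
          go : G y x → SymClosure (TransitiveReduction I) y x
          go (inj₁ (d , ¬z)) with longPath? I? I-noClosed y x
          ... | no ¬l = fwd ((y∈ , x∈ , d) , ¬l)
          -- Every other arc of the cycle is reversed, so their `Z`-walks combine to put y → x into
          -- `Z`.
          ... | yes l
            with _ , _ , r , s , _ , w₁ ← longPath⁻ l
            with _ , c , w₂ , t ← unsnoc (s ∷ w₁)
            with _ , w₃ ← flipʷ (r ∷ w₂) =
            contradiction (along-Z w (follow (noClosed-flip I-noClosed) (Sym.symmetric G ∘ I⇒G) un [] w yx len
              (t ∷ w₃) (within (noClosed-flip I-noClosed) proj₁ (t ∷ w₃))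
              λ { refl → inj₂ λ { refl → I-noClosed w₂ r } })) ¬z
          go (inj₂ (d , z)) with longPath? I? I-noClosed x y
          ... | no ¬l = bwd ((x∈ , y∈ , d) , ¬l)
          -- Every other arc of the cycle is kept, so they form an `N`-walk parallel to the `Z`-arc
          -- x → y.
          ... | yes l
            with _ , _ , r , s , _ , w₁ ← longPath⁻ l =
            contradiction z (N-walk⇒¬Z (noClosed⇒≢ D-noClosed d) (along-N w
              (follow I-noClosed I⇒G un [] w yx len
              (r ∷ s ∷ w₁) (within I-noClosed (proj₁ ∘ proj₂) (r ∷ s ∷ w₁))
              λ { refl → inj₂ λ { refl → I-noClosed w₁ s } })))

        -- Rotating the cycle makes each of its arcs the closing one in turn.
        all-arcs : Walk G x xs a → Walk G a zs y → G y x → xs ++ zs ≡ ws → length ws ≡ L →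
          (∀ {z} → z ∈ x ∷ ws → z ∈ˢ U) → (∀ {z} → z ∈ˢ U → z ∈ x ∷ ws) →
          Walk (SymClosure (TransitiveReduction I)) a zs y
        all-arcs _ [] _ _ _ _ _ = []
        all-arcs {x = x} {xs = xs} {zs = z ∷ zs} w₀ (g ∷ w) yx refl len ∈U U∈ =
          closing-arc (w ++ʷ (yx ∷ w₀)) g len′
            (∈U (there (∈-++⁺ʳ xs (here refl)))) (∈U (∈-++⁺ˡ (end∈ w₀)))
            (Sum.[ ∈-++⁺ʳ (z ∷ zs) , ∈-++⁺ˡ ]′ ∘ ∈-++⁻ (x ∷ xs) ∘ U∈)
          ∷ all-arcs (w₀ ++ʷ (g ∷ [])) w yx (++-assoc xs (z ∷ []) zs) len ∈U U∈
          where
          len′ : length (zs ++ x ∷ xs) ≡ L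
          len′ = trans (length-++-sucʳ zs x xs) (trans (sym (length-++-comm xs (z ∷ zs))) len)

      no-cycle : Walk G x xs y → G y x → length xs ≢ L
      -- Cycles on one or two vertices are not seen by the forest condition; asymmetry excludes
      -- them.
      no-cycle [] g _ = G-asym g g
      no-cycle (g ∷ []) g′ _ = G-asym g g′
      no-cycle {x = x} {xs = xs} w@(_ ∷ _ ∷ _) g len =
        vert U (x , xs , s≤s (s≤s (s≤s z≤n)) ,
          walk⇒linked (all-arcs U [] w g refl len ∈-fromList⁺ (∈-fromList⁻ (x ∷ xs)))
            (closing-arc U w g len (∈-fromList⁺ {xs = x ∷ xs} (here refl))
              (∈-fromList⁺ (end∈ w)) (∈-fromList⁻ (x ∷ xs))) ,
          no-shorter⇒unique (ℕ.≤-reflexive len) w)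
        where U = fromList (x ∷ xs)

    G-noClosed′ : ∀ k → length xs < k → Walk G x xs y → ¬ G y x
    G-noClosed′ (suc k) (s≤s le) w g =
      ShortestCycle.no-cycle (λ lt → G-noClosed′ k (ℕ.<-≤-trans lt le)) w g refl

    G-noClosed : NoClosed G
    G-noClosed w = G-noClosed′ _ ℕ.≤-refl w

    join : AcyclicReorientation D
    join = reorient D D-simple Z? G-noClosed

    join-upperˡ : _≤ᴬᴿ_ D E join
    join-upperˡ r = reversed⁺ D D-simple Z? (proj₁ r) (-, inj₁ r ∷ [])

    join-upperʳ : _≤ᴬᴿ_ D F join
    join-upperʳ r = reversed⁺ D D-simple Z? (proj₁ r) (-, inj₂ r ∷ [])

    -- `H` reverses all arcs of a `P`-walk u ⇝ v, so keeping u → v would close a cycle in `H`.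
    join-least : ∀ H → _≤ᴬᴿ_ D E H → _≤ᴬᴿ_ D F H → _≤ᴬᴿ_ D join H
    join-least H E≤H F≤H r@(d , _) with proj₁ (sameEdges H) (fwd d)
    ... | bwd e = d , e
    ... | fwd e = contradiction e
      (acyclic⇒noClosed (acyclic H) (proj₂ (flipʷ (mapʷ P⇒H (proj₂ (reversed⁻ D D-simple Z? r))))))
      where
      P⇒H : P ⇒ flip (Arc (graph H))
      P⇒H (inj₁ r) = proj₂ (E≤H r)
      P⇒H (inj₂ r) = proj₂ (F≤H r)

  -- Meets by reversing all arcs

  opposite : AcyclicReorientation D → AcyclicReorientation D
  opposite E = record
    { graph           = digraph (flip (Digraph.arc (graph E)))
    ; isReorientation = record
      { simple    = record { loopless = loopless E ∘ sym ; oneArc = flip (oneArc E) }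
      ; sameEdges = symClosure-flip ∘ proj₁ (sameEdges E) , proj₂ (sameEdges E) ∘ symClosure-flip
      }
    ; acyclic         = noClosed⇒acyclic (noClosed-flip (acyclic⇒noClosed (acyclic E)))
    }

  opposite-antitone : ∀ E F → _≤ᴬᴿ_ D E F → _≤ᴬᴿ_ D (opposite F) (opposite E)
  opposite-antitone E F E≤F (d , uv) with proj₁ (sameEdges E) (fwd d)
  ... | fwd uv′ = d , uv′
  ... | bwd vu  = contradiction uv (oneArc F (proj₂ (E≤F (d , vu))))

  vertebrate⇒lattice : Vertebrate D → IsLatticePoset (AcyclicReorientationPoset D)
  vertebrate⇒lattice vert = join vert , (λ E F → opposite (join vert (opposite E) (opposite F))) , record
    { isPartialOrder = Poset.isPartialOrder (AcyclicReorientationPoset D)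
    ; supremum       = λ E F → join-upperˡ vert E F , join-upperʳ vert E F , join-least vert E F
    ; infimum        = λ E F →
        let E′ = opposite E
            F′ = opposite F
            J  = join vert E′ F′
        -- The arcs of `opposite E′` are those of `E` by computation, so antitonicity yields the
        -- bound by `E` itself.
        in opposite-antitone E′ J (join-upperˡ vert E′ F′)
         , opposite-antitone F′ J (join-upperʳ vert E′ F′)
         , λ H H≤E H≤F → opposite-antitone J (opposite H)
             (join-least vert E′ F′ (opposite H) (opposite-antitone H E H≤E) (opposite-antitone H F H≤F))
    }

theorem1 : (n : ℕ) (D : Digraph n) → Simple D → Acyclic (Arc D) →
    IsLatticePoset (AcyclicReorientationPoset D) ⇔ Vertebrate D
theorem1 n D simple acyclic = mk⇔ (lattice⇒vertebrate D simple acyclic) (vertebrate⇒lattice D simple acyclic)
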